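{- Let $V$ be a real normed space of finite dimension $d\ge1$ whose unit ball is a linear image of a $d$-dimensional cube (i.e. $V$ is linearly isometric to $(\mathbb R^d,\|\cdot\|_\infty)$). Let $U$ be an abelian group with a translation-invariant ultrametric, let $\Lambda\subset V\times U$ be a closed additive subgroup, and let $X=(V\times U)/\Lambda$ carry the quotient metric induced by the maximum product metric. Then for every $\alpha\in X$ and every integer $N\ge2$, $$g_N(\alpha)\le2^d+1.$$ If, in addition, the unit ball of the reduced real factor $\overline V$ is a linear image of a cube, choose corresponding cube coordinates on $\overline V$ (linear coordinates $x_1,\dots,x_{\dim\overline V}$ in which $\|v\|_{\overline V}=\max_i|x_i(v)|$), and let $k$ be the number of cube-coordinate directions occurring in the real projection of $\overline\Lambda$, i.e. the number of indices $i$ such that $x_i(v)\ne0$ for some $(v,u)\in\overline\Lambda$. Then $$g_N(\alpha)\le2^k+1,\qquad k\le\dim\overline V\le d.$$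
   Context: Metric setting. Write the ultrametric on $U$ as $d_U(u,w)=|u-w|_U$, so $|u+w|_U\le\max\{|u|_U,|w|_U\}$. On $V\times U$ put $|(v,u)|=\max\{\|v\|_V,|u|_U\}$; "closed" refers to the induced metric topology. On $X=(V\times U)/\Lambda$ put $\|a+\Lambda\|_X=\inf_{\lambda\in\Lambda}|a-\lambda|$ and $d_X(x,y)=\|x-y\|_X$. Nearest-neighbour distances. For $\alpha\in X$ and $N\ge2$ let $\mathcal O_N(\alpha)=\{0,\alpha,\dots,(N-1)\alpha\}$ as a set (repetitions discarded). If it has at least two points put $\delta_N(x)=\min_{y\in\mathcal O_N(\alpha),\,y\ne x}d_X(x,y)$ and $g_N(\alpha)=\#\{\delta_N(x):x\in\mathcal O_N(\alpha)\}$; if it is a singleton, $g_N(\alpha)=0$. Reduced real factor. $W=\{v\in V:(tv,0)\in\Lambda\text{ for every }t\in\mathbb R\}$, a linear subspace of $V$; $\overline V=V/W$ with the quotient norm; $\overline\Lambda$ is the image of $\Lambda$ in $\overline V\times U$. -}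

module Defs where

open import Level using (Level; suc)
open import Algebra.Bundles using (AbelianGroup; CommutativeRing; Group)
open import Algebra.Definitions using (Invertible)
import Algebra.Construct.DirectProduct as DirectProduct
import Algebra.Construct.NaturalChoice.Max as NaturalMax
import Algebra.Construct.NaturalChoice.Min as NaturalMin
import Algebra.Construct.Pointwise as Pointwise
import Algebra.Definitions.RawMonoid as RawMonoidDefs
open import Algebra.Module.Bundles using (LeftModule)
open import Algebra.Module.Morphism.Structures using (module LeftModuleMorphisms)
import Algebra.Properties.AbelianGroup as AbelianGroupProperties
import Algebra.Properties.CommutativeSemigroup as CommutativeSemigroupProperties
open import Axiom.ExcludedMiddle using (ExcludedMiddle)
open import Data.Fin.Base using (Fin)
open import Data.List.Base
  using (List; []; _∷_; allFin; deduplicate; filter; length; map; upTo)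
open import Data.Nat.Base using (ℕ)
open import Data.Product.Base using (∃; _×_; _,_; proj₁; proj₂)
import Data.Vec.Functional as Vector
open import Function.Metric.Definitions using (TranslationInvariant)
open import Function.Metric.Structures using (IsGeneralMetric)
open import Relation.Binary.Bundles using (TotalOrder)
open import Relation.Binary.Core using (Rel)
open import Relation.Binary.Definitions using (_Respects_)
open import Relation.Binary.Structures using (IsTotalOrder)
open import Relation.Nullary.Decidable.Core using (¬?)
open import Relation.Nullary.Negation.Core using (¬_)
open import Relation.Unary using (Pred; _∈_; ∁)

module Bounds {ℓ} {A : Set ℓ} (_≤_ : Rel A ℓ) where
  UpperBound LowerBound : Pred A ℓ → Pred A ℓ
  UpperBound P b = ∀ {x} → x ∈ P → x ≤ b
  LowerBound P b = ∀ {x} → x ∈ P → b ≤ x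

  IsSupremum IsInfimum : Pred A ℓ → Pred A ℓ
  IsSupremum P s = s ∈ UpperBound P × s ∈ LowerBound (UpperBound P)
  IsInfimum  P i = i ∈ LowerBound P × i ∈ UpperBound (LowerBound P)

-- The standard library has no real numbers.  They enter as an arbitrary
-- complete (least-upper-bound property) totally ordered field; classically
-- this determines them up to a unique isomorphism.

record CompleteOrderedField (ℓ : Level) : Set (suc ℓ) where
  field
    commutativeRing : CommutativeRing ℓ ℓ

  open CommutativeRing commutativeRing public

  infix 4 _≤_ _<_

  field
    _≤_ : Rel Carrier ℓ

  open Bounds _≤_ public

  field
    isTotalOrder : IsTotalOrder _≈_ _≤_
    0≉1          : ¬ (0# ≈ 1#)
    invertible   : ∀ x → ¬ (x ≈ 0#) → Invertible _≈_ 1# _*_ x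
    +-monoʳ-≤    : ∀ x {y z} → y ≤ z → x + y ≤ x + z
    *-nonneg     : ∀ {x y} → 0# ≤ x → 0# ≤ y → 0# ≤ x * y
    supremum     : ∀ P → ∃ P → ∃ (UpperBound P) → ∃ (IsSupremum P)

  totalOrder : TotalOrder ℓ ℓ ℓ
  totalOrder = record { isTotalOrder = isTotalOrder }

  _<_ : Rel Carrier ℓ
  x < y = x ≤ y × ¬ (x ≈ y)

  infimum : ∀ P → ∃ P → ∃ (LowerBound P) → ∃ (IsInfimum P)
  infimum P (x , x∈P) bounded =
    let s , s-ub , s-least = supremum (LowerBound P) bounded (x , λ b → b x∈P)
    in  s , (λ y∈P → s-least (λ b → b y∈P)) , s-ub

  open NaturalMax totalOrder public using (_⊔_; x≤x⊔y)
  open NaturalMin totalOrder public using (_⊓_)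

  ∣_∣ : Carrier → Carrier
  ∣ x ∣ = x ⊔ (- x)

  -- Only used on nonempty lists; the value on [] is arbitrary.
  minimum : List Carrier → Carrier
  minimum []           = 0#
  minimum (x ∷ [])     = x
  minimum (x ∷ y ∷ ys) = x ⊓ minimum (y ∷ ys)

record Subgroup {ℓ} (G : AbelianGroup ℓ ℓ) : Set (suc ℓ) where
  open AbelianGroup G
  field
    Member    : Pred Carrier ℓ
    resp      : Member Respects _≈_
    ε-closed  : ε ∈ Member
    ∙-closed  : ∀ {x y} → x ∈ Member → y ∈ Member → x ∙ y ∈ Member
    ⁻¹-closed : ∀ {x} → x ∈ Member → x ⁻¹ ∈ Member

module _ {ℓ} (G : AbelianGroup ℓ ℓ) (H : Subgroup G) where
  open AbelianGroup G
  open Group group using (_//_)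
  open Subgroup H
  open AbelianGroupProperties G
    using (⁻¹-anti-homo-//; ⁻¹-∙-comm; x≈y⇒x∙y⁻¹≈ε; \\-leftDividesˡ; \\-leftDividesʳ)
  open CommutativeSemigroupProperties commutativeSemigroup using (interchange)

  infix 4 _≈[mod]_
  _≈[mod]_ : Rel Carrier ℓ
  x ≈[mod] y = x // y ∈ Member

  ≈⇒≈[mod] : ∀ {x y} → x ≈ y → x ≈[mod] y
  ≈⇒≈[mod] x≈y = resp (sym (x≈y⇒x∙y⁻¹≈ε x≈y)) ε-closed

  private
    mod-sym : ∀ {x y} → x ≈[mod] y → y ≈[mod] x
    mod-sym {x} {y} p = resp (⁻¹-anti-homo-// x y) (⁻¹-closed p)

    mod-trans : ∀ {x y z} → x ≈[mod] y → y ≈[mod] z → x ≈[mod] z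
    mod-trans {x} {y} {z} p q = resp telescope (∙-closed p q)
      where
      telescope : (x // y) ∙ (y // z) ≈ x // z
      telescope = trans (assoc x (y ⁻¹) (y // z)) (∙-congˡ (\\-leftDividesʳ y (z ⁻¹)))

    mod-∙-cong : ∀ {x y u v} → x ≈[mod] y → u ≈[mod] v → x ∙ u ≈[mod] y ∙ v
    mod-∙-cong {x} {y} {u} {v} p q = resp
      (trans (interchange x (y ⁻¹) u (v ⁻¹)) (∙-congˡ (⁻¹-∙-comm y v)))
      (∙-closed p q)

    mod-⁻¹-cong : ∀ {x y} → x ≈[mod] y → x ⁻¹ ≈[mod] y ⁻¹
    mod-⁻¹-cong {x} {y} p = resp (sym (⁻¹-∙-comm x (y ⁻¹))) (⁻¹-closed p)

  quotientGroup : AbelianGroup ℓ ℓ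
  quotientGroup = record
    { _≈_ = _≈[mod]_
    ; _∙_ = _∙_
    ; ε   = ε
    ; _⁻¹ = _⁻¹
    ; isAbelianGroup = record
      { isGroup = record
        { isMonoid = record
          { isSemigroup = record
            { isMagma = record
              { isEquivalence = record
                { refl  = ≈⇒≈[mod] refl
                ; sym   = mod-sym
                ; trans = mod-trans
                }
              ; ∙-cong = mod-∙-cong
              }
            ; assoc = λ x y z → ≈⇒≈[mod] (assoc x y z)
            }
          ; identity = (λ x → ≈⇒≈[mod] (identityˡ x)) , (λ x → ≈⇒≈[mod] (identityʳ x))
          }
        ; inverse = (λ x → ≈⇒≈[mod] (inverseˡ x)) , (λ x → ≈⇒≈[mod] (inverseʳ x))
        ; ⁻¹-cong = mod-⁻¹-cong
        }
      ; comm = λ x y → ≈⇒≈[mod] (comm x y)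
      }
    }

module OverReals {ℓ} (ℝ : CompleteOrderedField ℓ) where
  open CompleteOrderedField ℝ using (0#; _≤_; _<_; _⊔_; ∣_∣; minimum) renaming
    ( Carrier to R; _≈_ to _≈ᵣ_; _+_ to _+ᵣ_; _*_ to _*ᵣ_ )
  private module ℝ = CompleteOrderedField ℝ

  -- An abelian group with a size function; it carries the distance
  -- ∣ x - y ∣.  Nonnegativity is the only law needed to form quotients; the
  -- laws of the norm on V and of the ultrametric on U are stated below.

  record SizedGroup : Set (suc ℓ) where
    field
      abelianGroup : AbelianGroup ℓ ℓ

    open AbelianGroup abelianGroup public
    open Group group public using (_//_)

    field
      size        : Carrier → R
      size-nonneg : ∀ x → 0# ≤ size x

    dist : Carrier → Carrier → R
    dist x y = size (x // y)

    IsOpen : Pred (Pred Carrier ℓ) ℓ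
    IsOpen S = ∀ {x} → x ∈ S →
      ∃ λ r → 0# < r × (∀ {y} → dist x y < r → y ∈ S)

    IsClosed : Pred (Pred Carrier ℓ) ℓ
    IsClosed S = IsOpen (∁ S)

  infixr 7 _×ₛ_
  _×ₛ_ : SizedGroup → SizedGroup → SizedGroup
  G ×ₛ H = record
    { abelianGroup = DirectProduct.abelianGroup G.abelianGroup H.abelianGroup
    ; size         = λ (g , h) → G.size g ⊔ H.size h
    ; size-nonneg  = λ (g , h) → ℝ≤.trans (G.size-nonneg g) (ℝ.x≤x⊔y _ _)
    }
    where
    module G = SizedGroup G
    module H = SizedGroup H
    module ℝ≤ = IsTotalOrder ℝ.isTotalOrder

  infixl 7 _/ₛ_
  _/ₛ_ : (G : SizedGroup) → Subgroup (SizedGroup.abelianGroup G) → SizedGroup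
  G /ₛ H = record
    { abelianGroup = quotientGroup abelianGroup H
    ; size         = λ x → proj₁ (inf x)
    ; size-nonneg  = λ x → proj₂ (proj₂ (inf x)) (nonneg x)
    }
    where
    open SizedGroup G
    open Subgroup H

    distancesToH : Carrier → Pred R ℓ
    distancesToH x r = ∃ λ h → h ∈ Member × r ≈ᵣ dist x h

    nonneg : ∀ x → 0# ∈ ℝ.LowerBound (distancesToH x)
    nonneg x (h , _ , r≈) =
      IsTotalOrder.≤-respʳ-≈ ℝ.isTotalOrder (ℝ.sym r≈) (size-nonneg (x // h))

    inf : ∀ x → ∃ (ℝ.IsInfimum (distancesToH x))
    inf x = ℝ.infimum (distancesToH x) (dist x ε , ε , ε-closed , ℝ.refl) (0# , nonneg x)

  VectorSpace : Set (suc ℓ)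
  VectorSpace = LeftModule ℝ.ring ℓ ℓ

  record NormedSpace : Set (suc ℓ) where
    field
      vectorSpace : VectorSpace

    open LeftModule vectorSpace public

    field
      ∥_∥            : Carrierᴹ → R
      ∥∥-cong        : ∀ {v w} → v ≈ᴹ w → ∥ v ∥ ≈ᵣ ∥ w ∥
      ∥∥-nonneg      : ∀ v → 0# ≤ ∥ v ∥
      ∥∥-definite    : ∀ {v} → ∥ v ∥ ≈ᵣ 0# → v ≈ᴹ 0ᴹ
      ∥∥-homogeneous : ∀ t v → ∥ t *ₗ v ∥ ≈ᵣ ∣ t ∣ *ᵣ ∥ v ∥
      ∥∥-triangle    : ∀ v w → ∥ v +ᴹ w ∥ ≤ ∥ v ∥ +ᵣ ∥ w ∥

    sizedGroup : SizedGroup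
    sizedGroup = record
      { abelianGroup = +ᴹ-abelianGroup
      ; size         = ∥_∥
      ; size-nonneg  = ∥∥-nonneg
      }

  record UltrametricGroup : Set (suc ℓ) where
    field
      abelianGroup : AbelianGroup ℓ ℓ

    open AbelianGroup abelianGroup public

    field
      d                    : Carrier → Carrier → R
      isUltrametric        : IsGeneralMetric _≈_ _≈ᵣ_ _≤_ 0# _⊔_ d
      translationInvariant : TranslationInvariant _≈ᵣ_ _∙_ d

    sizedGroup : SizedGroup
    sizedGroup = record
      { abelianGroup = abelianGroup
      ; size         = λ u → d u ε
      ; size-nonneg  = λ _ → IsGeneralMetric.nonNegative isUltrametric
      }

  ℝ^_ : ℕ → VectorSpace
  ℝ^ n = record
    { _*ₗ_ = λ t x i → t *ᵣ x i
    ; isLeftModule = record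
      { isLeftSemimodule = record
        { +ᴹ-isCommutativeMonoid = isCommutativeMonoid
        ; isPreleftSemimodule = record
          { *ₗ-cong      = λ s≈t x≈y i → ℝ.*-cong s≈t (x≈y i)
          ; *ₗ-zeroˡ     = λ x i → ℝ.zeroˡ (x i)
          ; *ₗ-distribʳ  = λ x s t i → ℝ.distribʳ (x i) s t
          ; *ₗ-identityˡ = λ x i → ℝ.*-identityˡ (x i)
          ; *ₗ-assoc     = λ s t x i → ℝ.*-assoc s t (x i)
          ; *ₗ-zeroʳ     = λ t i → ℝ.zeroʳ t
          ; *ₗ-distribˡ  = λ t x y i → ℝ.distribˡ t (x i) (y i)
          }
        }
      ; -ᴹ‿cong    = ⁻¹-cong
      ; -ᴹ‿inverse = inverse
      }
    }
    where open AbelianGroup (Pointwise.abelianGroup (Fin n) ℝ.+-abelianGroup)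

  ∥_∥∞ : ∀ {n} → (Fin n → R) → R
  ∥ x ∥∞ = Vector.foldr _⊔_ 0# (λ i → ∣ x i ∣)

  -- A linear isometry onto (ℝⁿ , ∥_∥∞), the inverse of a linear map carrying
  -- the cube [-1,1]ⁿ onto the unit ball; in particular M has dimension n.

  record CubeCoordinates
    (M : VectorSpace) (norm : LeftModule.Carrierᴹ M → R) (n : ℕ) : Set ℓ where
    open LeftModule M using (Carrierᴹ; rawLeftModule)
    open LeftModuleMorphisms rawLeftModule (LeftModule.rawLeftModule (ℝ^ n))
    field
      coord               : Carrierᴹ → Fin n → R
      isLinearIsomorphism : IsLeftModuleIsomorphism coord
      isometric           : ∀ v → norm v ≈ᵣ ∥ coord v ∥∞

  module Gaps (em : ExcludedMiddle ℓ) (X : SizedGroup) where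
    open SizedGroup X
    open RawMonoidDefs rawMonoid using () renaming (_×_ to _·_)

    orbit : ℕ → Carrier → List Carrier
    orbit N α = deduplicate (λ x y → em {P = x ≈ y}) (map (_· α) (upTo N))

    nearestDistance : List Carrier → Carrier → R
    nearestDistance O x = minimum (map (dist x) (filter (λ y → ¬? (em {P = y ≈ x})) O))

    distanceValues : List Carrier → List R
    distanceValues O =
      deduplicate (λ r s → em {P = r ≈ᵣ s}) (map (nearestDistance O) O)

    countDistances : List Carrier → ℕ
    countDistances []             = 0
    countDistances (_ ∷ [])       = 0
    countDistances O@(_ ∷ _ ∷ _)  = length (distanceValues O)

    gapCount : ℕ → Carrier → ℕ
    gapCount N α = countDistances (orbit N α)

  module Quotient
    (V : NormedSpace) (U : UltrametricGroup)
    (Λ : Subgroup (SizedGroup.abelianGroup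
                    (NormedSpace.sizedGroup V ×ₛ UltrametricGroup.sizedGroup U)))
    where
    private
      module V = NormedSpace V
      module U = UltrametricGroup U
      module Λ = Subgroup Λ

    V×U : SizedGroup
    V×U = V.sizedGroup ×ₛ U.sizedGroup

    X : SizedGroup
    X = V×U /ₛ Λ

    InW : Pred V.Carrierᴹ ℓ
    InW v = ∀ t → (t V.*ₗ v , U.ε) ∈ Λ.Member

    private
      module VP = AbelianGroupProperties V.+ᴹ-abelianGroup
      module UP = AbelianGroupProperties U.abelianGroup

      *ₗ-neg : ∀ t v → t V.*ₗ (V.-ᴹ v) V.≈ᴹ V.-ᴹ (t V.*ₗ v)
      *ₗ-neg t v = VP.inverseˡ-unique _ _
        (V.≈ᴹ-trans (V.≈ᴹ-sym (V.*ₗ-distribˡ t (V.-ᴹ v) v))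
        (V.≈ᴹ-trans (V.*ₗ-congˡ (proj₁ V.-ᴹ‿inverse v)) (V.*ₗ-zeroʳ t)))

    W : Subgroup V.+ᴹ-abelianGroup
    W = record
      { Member    = InW
      ; resp      = λ v≈w v∈W t → Λ.resp (V.*ₗ-congˡ v≈w , U.refl) (v∈W t)
      ; ε-closed  = λ t → Λ.resp (V.≈ᴹ-sym (V.*ₗ-zeroʳ t) , U.refl) Λ.ε-closed
      ; ∙-closed  = λ {v} {w} v∈W w∈W t →
          Λ.resp (V.≈ᴹ-sym (V.*ₗ-distribˡ t v w) , U.identityˡ U.ε)
                 (Λ.∙-closed (v∈W t) (w∈W t))
      ; ⁻¹-closed = λ {v} v∈W t →
          Λ.resp (V.≈ᴹ-sym (*ₗ-neg t v) , UP.ε⁻¹≈ε) (Λ.⁻¹-closed (v∈W t))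
      }

    W-scale : ∀ t {v} → v ∈ InW → t V.*ₗ v ∈ InW
    W-scale t {v} v∈W s = Λ.resp (V.*ₗ-assoc s t v , U.refl) (v∈W (s *ᵣ t))

    sizedV̄ : SizedGroup
    sizedV̄ = V.sizedGroup /ₛ W

    V̄ : VectorSpace
    V̄ = record
      { _*ₗ_ = V._*ₗ_
      ; isLeftModule = record
        { isLeftSemimodule = record
          { +ᴹ-isCommutativeMonoid = V̄.isCommutativeMonoid
          ; isPreleftSemimodule = record
            { *ₗ-cong      = *ₗ-cong
            ; *ₗ-zeroˡ     = λ v → lift (V.*ₗ-zeroˡ v)
            ; *ₗ-distribʳ  = λ v s t → lift (V.*ₗ-distribʳ v s t)
            ; *ₗ-identityˡ = λ v → lift (V.*ₗ-identityˡ v)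
            ; *ₗ-assoc     = λ s t v → lift (V.*ₗ-assoc s t v)
            ; *ₗ-zeroʳ     = λ t → lift (V.*ₗ-zeroʳ t)
            ; *ₗ-distribˡ  = λ t v w → lift (V.*ₗ-distribˡ t v w)
            }
          }
        ; -ᴹ‿cong    = V̄.⁻¹-cong
        ; -ᴹ‿inverse = V̄.inverse
        }
      }
      where
      module V̄ = SizedGroup sizedV̄

      lift : ∀ {v w} → v V.≈ᴹ w → v V̄.≈ w
      lift = ≈⇒≈[mod] V.+ᴹ-abelianGroup W

      *ₗ-cong : ∀ {s t v w} → s ≈ᵣ t → v V̄.≈ w → (s V.*ₗ v) V̄.≈ (t V.*ₗ w)
      *ₗ-cong {s} {t} {v} {w} s≈t v≈w = Subgroup.resp W
        (V.≈ᴹ-trans (V.*ₗ-distribˡ t v (V.-ᴹ w))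
                    (V.+ᴹ-cong (V.*ₗ-congʳ (ℝ.sym s≈t)) (*ₗ-neg t w)))
        (W-scale t v≈w)

    ∥_∥V̄ : LeftModule.Carrierᴹ V̄ → R
    ∥_∥V̄ = SizedGroup.size sizedV̄

    V̄×U : AbelianGroup ℓ ℓ
    V̄×U = SizedGroup.abelianGroup (sizedV̄ ×ₛ U.sizedGroup)

    -- The projection V × U → V̄ × U is the identity on representatives.
    Λ̄ : Pred (AbelianGroup.Carrier V̄×U) ℓ
    Λ̄ a = ∃ λ b → b ∈ Λ.Member × AbelianGroup._≈_ V̄×U b a

    module _ {n} (x : CubeCoordinates V̄ ∥_∥V̄ n) where
      open CubeCoordinates x

      Occurs : Pred (Fin n) ℓ
      Occurs i = ∃ λ ((v , u) : AbelianGroup.Carrier V̄×U) →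
        (v , u) ∈ Λ̄ × ¬ (coord v i ≈ᵣ 0#)

      occurringDirections : ExcludedMiddle ℓ → ℕ
      occurringDirections em = length (filter (λ i → em {P = Occurs i}) (allFin n))

{-# OPTIONS --safe #-}

-- The nearest-neighbour distance at n · α is the least nonzero ∥ m · α ∥ with
-- m ≤ max (n , N - 1 - n).  Let T be the one at the middle of the orbit; every other value
-- is some ∥ m · α ∥ < T, and any two such m differ by so little that ∥ (m - m′) · α ∥ ≥ T.
-- Choose representatives of these m · α of norm < T.  No two of them lie in the same
-- orthant, since vectors of sup norm < T in one orthant are at sup distance < T, and so
-- are any two elements of size < T of an ultrametric group.  So there are at most as many
-- values below T as there are orthants.  A coordinate that vanishes on Λ does not depend
-- on the representative; on m · α it has the sign it has on α, so it does not contribute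
-- to the number of orthants.
module Submission where

open import Defs
import Algebra.Construct.NaturalChoice.Max as NaturalMax
import Algebra.Construct.NaturalChoice.Min as NaturalMin
import Algebra.Definitions.RawMonoid as RawMonoidDefs
open import Algebra.Module.Bundles using (LeftModule)
open import Algebra.Module.Morphism.Structures using (module LeftModuleMorphisms)
import Algebra.Properties.AbelianGroup as AbelianGroupProperties
import Algebra.Properties.Monoid.Mult as MonoidMult
import Algebra.Properties.Ring as RingProperties
open import Axiom.ExcludedMiddle using (ExcludedMiddle)
open import Data.Fin.Base as Fin using (Fin; zero; suc; combine; finToFun; funToFin)
open import Data.Fin.Properties using (<⇒≢; finToFun-funToFin; funToFin-finToFin; pigeonhole)
open import Data.List.Base
  using (List; []; _∷_; allFin; filter; length; lookup; map; upTo)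
open import Data.List.Membership.Propositional using (_∈_; find)
open import Data.List.Membership.Propositional.Properties as ∈
  using (∈-allFin; ∈-filter⁺; ∈-filter⁻; ∈-lookup; ∈-map⁺; ∈-map⁻; ∈-upTo⁺; ∈-upTo⁻)
import Data.List.Membership.Setoid.Properties as Setoid∈
open import Data.List.Properties using (length-filter; length-tabulate)
open import Data.List.Relation.Unary.All as All using ([]; _∷_)
open import Data.List.Relation.Unary.AllPairs using (AllPairs; []; _∷_)
open import Data.List.Relation.Unary.Any as Any using (here; there)
open import Data.List.Relation.Unary.Any.Properties using (lookup-index)
open import Data.List.Relation.Unary.Unique.DecSetoid.Properties using (deduplicate-!)
open import Data.Nat.Base as ℕ using (ℕ; zero; suc; z≤n; s≤s; _+_; _^_; _≤_; ⌊_/2⌋)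
import Data.Nat.Properties as ℕ
open import Data.Product.Base using (∃; _×_; _,_; proj₁; proj₂)
open import Data.Sum.Base using (_⊎_; inj₁; inj₂; [_,_]′)
open import Function.Base using (_∘_)
open import Function.Metric.Structures using (IsGeneralMetric)
open import Level using (Level)
open import Relation.Binary.Core using (Rel)
open import Relation.Binary.Definitions using (Trans)
import Relation.Binary.Construct.NonStrictToStrict as ToStrict
open import Relation.Binary.PropositionalEquality as ≡ using (_≡_; refl)
open import Relation.Binary.Structures using (IsTotalOrder)
open import Relation.Nullary.Decidable.Core using (yes; no; ¬?)
open import Relation.Nullary.Negation.Core using (¬_; contradiction)

private
  variable
    a p r : Level
    A : Set a

-- Pigeonhole bounds and codes of functions between finite sets.

AllPairs-lookup : {R : Rel A r} {xs : List A} → AllPairs R xs →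
                  ∀ {i j} → i Fin.< j → R (lookup xs i) (lookup xs j)
AllPairs-lookup {xs = _ ∷ xs} (Rx ∷ _) {zero} {suc j} _ = All.lookup Rx (∈-lookup {xs = xs} j)
AllPairs-lookup (_ ∷ Rxs) {suc i} {suc j} (s≤s i<j) = AllPairs-lookup Rxs i<j

-- In a list with more than `k` entries two positions would receive one colour, which `injective`
-- turns into equal entries. Colours form a relation, since an entry may admit several.
length≤colours : ∀ {_≈_ : Rel A r} {k} {_~_ : A → Fin k → Set p} {xs : List A} →
  AllPairs (λ x y → ¬ x ≈ y) xs → (∀ {x} → x ∈ xs → ∃ (x ~_)) →
  (∀ {x y c} → x ~ c → y ~ c → x ≈ y) → length xs ≤ k
length≤colours {_~_ = _~_} {xs} distinct colour injective = ℕ.≮⇒≥ λ k<length →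
  let i , j , i<j , same = pigeonhole k<length (λ i → proj₁ (coloured i))
  in AllPairs-lookup distinct i<j
       (injective (proj₂ (coloured i)) (≡.subst (lookup xs j ~_) (≡.sym same) (proj₂ (coloured j))))
  where
  coloured : ∀ i → ∃ (lookup xs i ~_)
  coloured i = colour (∈-lookup {xs = xs} i)

funToFin-cong : ∀ {m n} {f g : Fin m → Fin n} → (∀ i → f i ≡ g i) → funToFin f ≡ funToFin g
funToFin-cong {zero}  f≗g = refl
funToFin-cong {suc m} f≗g = ≡.cong₂ combine (f≗g zero) (funToFin-cong (f≗g ∘ suc))

finToFun-injective : ∀ {m n} (c c′ : Fin (m ^ n)) →
  (∀ i → finToFun {m} {n} c i ≡ finToFun {m} {n} c′ i) → c ≡ c′
finToFun-injective {m} {n} c c′ eq = ≡.trans (≡.sym (funToFin-finToFin {n} {m} c))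
  (≡.trans (funToFin-cong {f = finToFun {m} {n} c} {g = finToFun {m} {n} c′} eq)
    (funToFin-finToFin {n} {m} c′))

-- Index arithmetic: what is within reach of the middle.

-- Some element of {0 , … , N - 1} is at distance m from n.
Reach : ℕ → ℕ → ℕ → Set
Reach N n m = n + m ℕ.< N ⊎ m ≤ n

⌊n/2⌋+⌊n/2⌋≤n : ∀ n → ⌊ n /2⌋ + ⌊ n /2⌋ ≤ n
⌊n/2⌋+⌊n/2⌋≤n n = begin
  ⌊ n /2⌋ + ⌊ n /2⌋  ≤⟨ ℕ.+-monoʳ-≤ ⌊ n /2⌋ (ℕ.⌊n/2⌋≤⌈n/2⌉ n) ⟩
  ⌊ n /2⌋ + ℕ.⌈ n /2⌉ ≡⟨ ℕ.⌊n/2⌋+⌈n/2⌉≡n n ⟩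
  n                  ∎
  where open ℕ.≤-Reasoning

n≤1+⌊n/2⌋+⌊n/2⌋ : ∀ n → n ≤ suc (⌊ n /2⌋ + ⌊ n /2⌋)
n≤1+⌊n/2⌋+⌊n/2⌋ zero          = z≤n
n≤1+⌊n/2⌋+⌊n/2⌋ (suc zero)    = s≤s z≤n
n≤1+⌊n/2⌋+⌊n/2⌋ (suc (suc n)) = s≤s (ℕ.≤-trans (s≤s (n≤1+⌊n/2⌋+⌊n/2⌋ n))
  (ℕ.≤-reflexive (≡.cong suc (≡.sym (ℕ.+-suc ⌊ n /2⌋ ⌊ n /2⌋)))))

module _ {P : ℕ} where

  private
    h = ⌊ P /2⌋

  -- From `n` one reaches every distance up to the larger of `n` and `P - n`, and `h` makes this
  -- maximum least.
  Reach-middle⇒Reach : ∀ {n m} → n ≤ P → Reach (suc P) h m → Reach (suc P) n m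
  Reach-middle⇒Reach {n} {m} n≤P reach with m ℕ.≤? n | m ℕ.≤? h
  ... | yes m≤n | _       = inj₂ m≤n
  ... | no  m≰n | yes m≤h = inj₁ (s≤s (begin
    n + m ≤⟨ ℕ.+-mono-≤ (ℕ.≤-trans (ℕ.<⇒≤ (ℕ.≰⇒> m≰n)) m≤h) m≤h ⟩
    h + h ≤⟨ ⌊n/2⌋+⌊n/2⌋≤n P ⟩
    P     ∎))
    where open ℕ.≤-Reasoning
  ... | no  m≰n | no  m≰h with reach
  ...   | inj₂ m≤h       = contradiction m≤h m≰h
  ...   | inj₁ (s≤s h+m≤P) = inj₁ (ℕ.≤-<-trans (ℕ.+-monoˡ-≤ m n≤h) (s≤s h+m≤P))
    where
    -- Rounding down costs at most one: `P ≤ suc (h + h)`. So only the distance `suc h` is left, and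
    -- `n < m` puts `n` in the left half.
    m≤1+h : m ≤ suc h
    m≤1+h = ℕ.+-cancelˡ-≤ h m (suc h) (ℕ.≤-trans h+m≤P
      (ℕ.≤-trans (n≤1+⌊n/2⌋+⌊n/2⌋ P) (ℕ.≤-reflexive (≡.sym (ℕ.+-suc h h)))))

    n≤h : n ≤ h
    n≤h = ℕ.≤-pred (ℕ.≤-trans (ℕ.≰⇒> m≰n) m≤1+h)

  Reach⇒< : ∀ {n m} → n ≤ P → Reach (suc P) n m → m ℕ.< suc P
  Reach⇒< {n} {m} _   (inj₁ n+m<N) = ℕ.≤-<-trans (ℕ.m≤n+m m n) n+m<N
  Reach⇒<         n≤P (inj₂ m≤n)   = s≤s (ℕ.≤-trans m≤n n≤P)

  -- Being out of reach to the right means `suc P ≤ h + m`; comparison with `m + p < suc P` leaves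
  -- `p < h`.
  ¬Reach⇒Reach-difference : ∀ {m p} → ¬ Reach (suc P) h m → m + p ℕ.< suc P →
                            Reach (suc P) h p
  ¬Reach⇒Reach-difference {m} {p} ¬reach m+p<N = inj₂ (ℕ.<⇒≤ (ℕ.+-cancelˡ-< m p h
    (ℕ.<-≤-trans m+p<N (ℕ.≤-trans (ℕ.≮⇒≥ (¬reach ∘ inj₁)) (ℕ.≤-reflexive (ℕ.+-comm h m))))))

-- Ordered-field inequalities, signs and orthants.

module RealField {ℓ} (em : ExcludedMiddle ℓ) (ℝ : CompleteOrderedField ℓ) where
  open CompleteOrderedField ℝ public
    hiding (zero) renaming (Carrier to R; refl to ≈-refl; _≤_ to _≤ᵣ_; _<_ to _<ᵣ_; _+_ to _+ᵣ_; _*_ to _*ᵣ_)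
  open NaturalMax totalOrder public using (⊔-sel; ⊔-comm; ⊔-cong; x≤y⊔x)
  open NaturalMin totalOrder public using (⊓-sel; x⊓y≤x; x⊓y≤y)
  open AbelianGroupProperties +-abelianGroup public
    using (⁻¹-anti-homo‿-; ⁻¹-involutive; identityʳ-unique)
  open RingProperties ring public using (-1*x≈-x)
  module ≤ = IsTotalOrder isTotalOrder

  <-≤-trans : Trans _<ᵣ_ _≤ᵣ_ _<ᵣ_
  <-≤-trans = ToStrict.<-≤-trans _≈_ _≤ᵣ_ sym ≤.trans ≤.antisym ≤.≤-respʳ-≈

  ≤-<-trans : Trans _≤ᵣ_ _<ᵣ_ _<ᵣ_
  ≤-<-trans = ToStrict.≤-<-trans _≈_ _≤ᵣ_ ≤.trans ≤.antisym ≤.≤-respˡ-≈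

  ≈-<-trans : Trans _≈_ _<ᵣ_ _<ᵣ_
  ≈-<-trans x≈y = ≤-<-trans (≤.reflexive x≈y)

  <-irrefl : ∀ {x} → ¬ x <ᵣ x
  <-irrefl (_ , x≉x) = x≉x (≈-refl)

  <⇒≱ : ∀ {x y} → x <ᵣ y → ¬ y ≤ᵣ x
  <⇒≱ = ToStrict.<⇒≱ _≈_ _≤ᵣ_ ≤.antisym

  ≮⇒≥ : ∀ {x y} → ¬ x <ᵣ y → y ≤ᵣ x
  ≮⇒≥ = ToStrict.≮⇒≥ _≈_ _≤ᵣ_ sym (λ _ _ → em) ≤.reflexive ≤.total

  ⊔-< : ∀ {x y t} → x <ᵣ t → y <ᵣ t → x ⊔ y <ᵣ t
  ⊔-< {x} {y} x<t y<t with ⊔-sel x y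
  ... | inj₁ x⊔y≈x = ≈-<-trans x⊔y≈x x<t
  ... | inj₂ x⊔y≈y = ≈-<-trans x⊔y≈y y<t

  ⊔-<⁻ : ∀ {x y t} → x ⊔ y <ᵣ t → x <ᵣ t × y <ᵣ t
  ⊔-<⁻ {x} {y} x⊔y<t = ≤-<-trans (x≤x⊔y x y) x⊔y<t , ≤-<-trans (x≤y⊔x x y) x⊔y<t

  x≤0⇒x+y≤y : ∀ {x y} → x ≤ᵣ 0# → x +ᵣ y ≤ᵣ y
  x≤0⇒x+y≤y {x} {y} x≤0 = ≤.trans (≤.reflexive (+-comm x y))
    (≤.trans (+-monoʳ-≤ y x≤0) (≤.reflexive (+-identityʳ y)))

  0≤x⇒y≤x+y : ∀ {x y} → 0# ≤ᵣ x → y ≤ᵣ x +ᵣ y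
  0≤x⇒y≤x+y {x} {y} 0≤x = ≤.trans (≤.reflexive (sym (+-identityʳ y)))
    (≤.trans (+-monoʳ-≤ y 0≤x) (≤.reflexive (+-comm y x)))

  0≤x⇒-x≤0 : ∀ {x} → 0# ≤ᵣ x → - x ≤ᵣ 0#
  0≤x⇒-x≤0 {x} 0≤x = ≤.trans (0≤x⇒y≤x+y 0≤x) (≤.reflexive (-‿inverseʳ x))

  ∣-∣-cong : ∀ {x y} → x ≈ y → ∣ x ∣ ≈ ∣ y ∣
  ∣-∣-cong x≈y = ⊔-cong x≈y (-‿cong x≈y)

  ∣-x∣<t : ∀ {x t} → ∣ x ∣ <ᵣ t → ∣ - x ∣ <ᵣ t
  ∣-x∣<t {x} ∣x∣<t = let x<t , -x<t = ⊔-<⁻ ∣x∣<t in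
    ⊔-< -x<t (≈-<-trans (⁻¹-involutive x) x<t)

  -- Zero agrees with either sign, so that all natural multiples of one number, including zero,
  -- share a sign.
  SameSign : R → R → Set ℓ
  SameSign x y = (0# ≤ᵣ x × 0# ≤ᵣ y) ⊎ (x ≤ᵣ 0# × y ≤ᵣ 0#)

  -- For nonnegative numbers `x - y ≤ x` and `y - x ≤ y`; for nonpositive ones the bounds are `- y`
  -- and `- x`.
  SameSign⇒∣x-y∣<t : ∀ {x y t} → SameSign x y → ∣ x ∣ <ᵣ t → ∣ y ∣ <ᵣ t → ∣ x +ᵣ - y ∣ <ᵣ t
  SameSign⇒∣x-y∣<t {x} {y} {t} same ∣x∣<t ∣y∣<t = [ nonneg , nonpos ]′ same
    where
    x<t = proj₁ (⊔-<⁻ ∣x∣<t)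
    y<t = proj₁ (⊔-<⁻ ∣y∣<t)
    -x<t = proj₂ (⊔-<⁻ ∣x∣<t)
    -y<t = proj₂ (⊔-<⁻ ∣y∣<t)

    both : x +ᵣ - y <ᵣ t → y +ᵣ - x <ᵣ t → ∣ x +ᵣ - y ∣ <ᵣ t
    both x-y<t y-x<t = ⊔-< x-y<t (≈-<-trans (⁻¹-anti-homo‿- x y) y-x<t)

    decrease : ∀ {z w} → 0# ≤ᵣ w → z +ᵣ - w ≤ᵣ z
    decrease {z} {w} 0≤w =
      ≤.trans (≤.reflexive (+-comm z (- w))) (x≤0⇒x+y≤y (0≤x⇒-x≤0 0≤w))

    nonneg : 0# ≤ᵣ x × 0# ≤ᵣ y → ∣ x +ᵣ - y ∣ <ᵣ t
    nonneg (0≤x , 0≤y) = both (≤-<-trans (decrease 0≤y) x<t) (≤-<-trans (decrease 0≤x) y<t)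

    nonpos : x ≤ᵣ 0# × y ≤ᵣ 0# → ∣ x +ᵣ - y ∣ <ᵣ t
    nonpos (x≤0 , y≤0) = both (≤-<-trans (x≤0⇒x+y≤y x≤0) -y<t) (≤-<-trans (x≤0⇒x+y≤y y≤0) -x<t)

  sign : R → Fin 2
  sign x with em {P = 0# ≤ᵣ x}
  ... | yes _ = zero
  ... | no  _ = suc zero

  sign-≡⇒SameSign : ∀ x y → sign x ≡ sign y → SameSign x y
  sign-≡⇒SameSign x y eq with em {P = 0# ≤ᵣ x} | em {P = 0# ≤ᵣ y}
  ... | yes 0≤x | yes 0≤y = inj₁ (0≤x , 0≤y)
  ... | no  0≰x | no  0≰y = inj₂ (nonpos 0≰x , nonpos 0≰y)
    where
    nonpos : ∀ {z} → ¬ 0# ≤ᵣ z → z ≤ᵣ 0#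
    nonpos {z} 0≰z = [ (λ z≤0 → z≤0) , (λ 0≤z → contradiction 0≤z 0≰z) ]′ (≤.total z 0#)

  orthant : ∀ {k} → (Fin k → R) → Fin (2 ^ k)
  orthant x = funToFin (sign ∘ x)

  orthant-≡⇒SameSign : ∀ {k} (x y : Fin k → R) → orthant x ≡ orthant y →
                       ∀ i → SameSign (x i) (y i)
  orthant-≡⇒SameSign x y eq i = sign-≡⇒SameSign (x i) (y i)
    (≡.trans (≡.sym (finToFun-funToFin (sign ∘ x) i))
      (≡.trans (≡.cong (λ c → finToFun c i) eq) (finToFun-funToFin (sign ∘ y) i)))

  open OverReals ℝ using (∥_∥∞) public

  ∥∥∞-<⁻ : ∀ {n t} (x : Fin n → R) → ∥ x ∥∞ <ᵣ t → ∀ i → ∣ x i ∣ <ᵣ t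
  ∥∥∞-<⁻ x x<t zero    = proj₁ (⊔-<⁻ x<t)
  ∥∥∞-<⁻ x x<t (suc i) = ∥∥∞-<⁻ (x ∘ suc) (proj₂ (⊔-<⁻ x<t)) i

  ∥∥∞-< : ∀ {n t} (x : Fin n → R) → 0# <ᵣ t → (∀ i → ∣ x i ∣ <ᵣ t) → ∥ x ∥∞ <ᵣ t
  ∥∥∞-< {zero}  x 0<t x<t = 0<t
  ∥∥∞-< {suc n} x 0<t x<t = ⊔-< (x<t zero) (∥∥∞-< (x ∘ suc) 0<t (x<t ∘ suc))

  minimum-∈ : ∀ x xs → ∃ λ y → y ∈ x ∷ xs × minimum (x ∷ xs) ≈ y
  minimum-∈ x []       = x , here refl , ≈-refl
  minimum-∈ x (y ∷ ys) with ⊓-sel x (minimum (y ∷ ys))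
  ... | inj₁ eq = x , here refl , eq
  ... | inj₂ eq = let z , z∈ , eq′ = minimum-∈ y ys in z , there z∈ , trans eq eq′

  minimum-≤ : ∀ {x} xs → x ∈ xs → minimum xs ≤ᵣ x
  minimum-≤ (x ∷ [])     (here refl) = ≤.refl
  minimum-≤ (x ∷ y ∷ ys) (here refl) = x⊓y≤x x (minimum (y ∷ ys))
  minimum-≤ (x ∷ y ∷ ys) (there z∈)  = ≤.trans (x⊓y≤y x (minimum (y ∷ ys))) (minimum-≤ (y ∷ ys) z∈)

  open OverReals ℝ

  -- Nearest-neighbour distances bounded by a colouring of the multiples.

  module ColourBound
    (X : SizedGroup)
    (size-cong : ∀ {x y} → SizedGroup._≈_ X x y → SizedGroup.size X x ≈ SizedGroup.size X y)
    (size-⁻¹ : ∀ x → SizedGroup.size X (SizedGroup._⁻¹ X x) ≈ SizedGroup.size X x)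
    (α : SizedGroup.Carrier X) (P : ℕ) where

    private module X = SizedGroup X
    open X using (_//_; size; dist) renaming (_≈_ to _≈ₓ_)
    open Gaps em X
    open RawMonoidDefs X.rawMonoid using () renaming (_×_ to _·_)
    open MonoidMult X.monoid using (×-homo-+)
    open AbelianGroupProperties X.abelianGroup
      using (xyx⁻¹≈y) renaming (⁻¹-anti-homo‿- to //-⁻¹)

    private
      N h : ℕ
      N = suc P
      h = ⌊ P /2⌋

      O : List X.Carrier
      O = orbit N α

    h≤P : h ≤ P
    h≤P = ℕ.⌊n/2⌋≤n P

    ∈-orbit⁻ : ∀ {x} → x ∈ O → ∃ λ n → n ≤ P × x ≡ n · α
    ∈-orbit⁻ x∈O with n , n∈ , x≡ ← ∈-map⁻ (_· α)
                        (∈.∈-deduplicate⁻ (λ _ _ → em) (map (_· α) (upTo N)) x∈O)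
                 with s≤s n≤P ← ∈-upTo⁻ n∈ = n , n≤P , x≡

    -- Deduplication keeps one of several equal points, so the multiple itself may be absent and
    -- only an equal point is found.
    ∈-orbit⁺ : ∀ {n} → n ≤ P → ∃ λ y → y ∈ O × n · α ≈ₓ y
    ∈-orbit⁺ n≤P = find (Setoid∈.∈-deduplicate⁺ X.setoid (λ _ _ → em)
      (λ z≈y x≈y → X.trans x≈y (X.sym z≈y))
      (Any.map X.reflexive (∈-map⁺ (_· α) (∈-upTo⁺ (s≤s n≤P)))))

    nearestDistance-attained : ∀ O {x y} → y ∈ O → ¬ y ≈ₓ x →
      ∃ λ z → z ∈ O × ¬ z ≈ₓ x × nearestDistance O x ≈ dist x z
    nearestDistance-attained O {x} y∈O y≉x
      -- The membership facts are abstracted together with the filtered list so that their types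
      -- follow the match. The one for `y` excludes the empty list, and with it the default value of
      -- `minimum`.
      with filter (λ y → ¬? (em {P = y ≈ₓ x})) O
         | ∈-filter⁺ (λ y → ¬? (em {P = y ≈ₓ x})) y∈O y≉x
         | (λ {v} → ∈-filter⁻ (λ y → ¬? (em {P = y ≈ₓ x})) {v} {O})
    ... | z ∷ zs | _ | filter⁻
      with d , d∈ , eq ← minimum-∈ (dist x z) (map (dist x) zs)
      with w , w∈ , refl ← ∈-map⁻ (dist x) d∈
      with w∈O , w≉x ← filter⁻ w∈ = w , w∈O , w≉x , eq

    nearestDistance-≤ : ∀ O {x y} → y ∈ O → ¬ y ≈ₓ x → nearestDistance O x ≤ᵣ dist x y
    nearestDistance-≤ O {x} y∈O y≉x =
      minimum-≤ _ (∈-map⁺ (dist x) (∈-filter⁺ (λ y → ¬? (em {P = y ≈ₓ x})) y∈O y≉x))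

    ·-// : ∀ j m → (j + m) · α // j · α ≈ₓ m · α
    ·-// j m = X.trans (X.∙-congʳ (×-homo-+ α j m)) (xyx⁻¹≈y (j · α) (m · α))

    dist-·ʳ : ∀ j m → dist ((j + m) · α) (j · α) ≈ size (m · α)
    dist-·ʳ j m = size-cong (·-// j m)

    dist-·ˡ : ∀ j m → dist (j · α) ((j + m) · α) ≈ size (m · α)
    dist-·ˡ j m = trans
      (size-cong (X.trans (X.sym (//-⁻¹ ((j + m) · α) (j · α))) (X.⁻¹-cong (·-// j m))))
      (size-⁻¹ (m · α))

    ·≈ε⇒·-≈ : ∀ j m → m · α ≈ₓ X.ε → (j + m) · α ≈ₓ j · α
    ·≈ε⇒·-≈ j m mα≈ε = X.trans (×-homo-+ α j m)
      (X.trans (X.∙-congˡ mα≈ε) (X.identityʳ (j · α)))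

    ·-≈⇒·≈ε : ∀ j m → (j + m) · α ≈ₓ j · α → m · α ≈ₓ X.ε
    ·-≈⇒·≈ε j m eq = X.trans (X.sym (·-// j m)) (X.trans (X.∙-congʳ eq) (X.inverseʳ (j · α)))

    δ : ℕ → R
    δ n = nearestDistance O (n · α)

    δ-≤ : ∀ {n m} → n ≤ P → Reach N n m → ¬ m · α ≈ₓ X.ε → δ n ≤ᵣ size (m · α)
    δ-≤ {n} {m} n≤P (inj₁ (s≤s n+m≤P)) mα≉ε with y , y∈O , eq ← ∈-orbit⁺ n+m≤P =
      ≤.trans
        (nearestDistance-≤ O y∈O (λ y≈x → mα≉ε (·-≈⇒·≈ε n m (X.trans eq y≈x))))
        (≤.reflexive (trans (size-cong (X.∙-congˡ (X.⁻¹-cong (X.sym eq)))) (dist-·ˡ n m)))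
    δ-≤ {n} {m} n≤P (inj₂ m≤n) mα≉ε with ℕ.m≤n⇒∃[o]m+o≡n m≤n
    ... | j , m+j≡n with refl ← ≡.trans (ℕ.+-comm j m) m+j≡n
      with y , y∈O , eq ← ∈-orbit⁺ (ℕ.m+n≤o⇒m≤o j n≤P) =
      ≤.trans
        (nearestDistance-≤ O y∈O (λ y≈x → mα≉ε (·-≈⇒·≈ε j m (X.sym (X.trans eq y≈x)))))
        (≤.reflexive (trans (size-cong (X.∙-congˡ (X.⁻¹-cong (X.sym eq)))) (dist-·ʳ j m)))

    module _ {x y} (x∈O : x ∈ O) (y∈O : y ∈ O) (x≉y : ¬ x ≈ₓ y) where

      ∃-≉ : ∀ z → ∃ λ w → w ∈ O × ¬ w ≈ₓ z
      ∃-≉ z with em {P = x ≈ₓ z}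
      ... | yes x≈z = y , y∈O , λ y≈z → x≉y (X.trans x≈z (X.sym y≈z))
      ... | no  x≉z = x , x∈O , x≉z

      -- A nearest neighbour is some `j · α`, and `m` is the gap between `j` and `n`. Together with
      -- `δ-≤` this identifies `δ n` as a minimum over the reach of `n`.
      δ-attained : ∀ {n} → n ≤ P →
        ∃ λ m → Reach N n m × ¬ m · α ≈ₓ X.ε × δ n ≈ size (m · α)
      δ-attained {n} n≤P
        with w , w∈O , w≉ ← ∃-≉ (n · α)
        with z , z∈O , z≉ , eq ← nearestDistance-attained O w∈O w≉
        with j , j≤P , refl ← ∈-orbit⁻ z∈O
        with ℕ.≤-total j n
      ... | inj₁ j≤n with m , refl ← ℕ.m≤n⇒∃[o]m+o≡n j≤n =
        m , inj₂ (ℕ.m≤n+m m j) , (λ mα≈ε → z≉ (X.sym (·≈ε⇒·-≈ j m mα≈ε))) , trans eq (dist-·ʳ j m)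
      ... | inj₂ n≤j with m , refl ← ℕ.m≤n⇒∃[o]m+o≡n n≤j =
        m , inj₁ (s≤s j≤P) , (λ mα≈ε → z≉ (·≈ε⇒·-≈ n m mα≈ε)) , trans eq (dist-·ˡ n m)

      T : R
      T = δ h

      -- The multiple that realises `T` lies within reach of every index, so it competes in every
      -- `δ n`.
      δ-≤-T : ∀ {n} → n ≤ P → δ n ≤ᵣ T
      δ-≤-T n≤P = let m , reach , mα≉ε , T≈ = δ-attained h≤P in
        ≤.trans (δ-≤ n≤P (Reach-middle⇒Reach n≤P reach) mα≉ε) (≤.reflexive (sym T≈))

      module _ {k} (_∶_↦_ : R → ℕ → Fin k → Set ℓ)
        (coloured : ∀ {t m} → size (m · α) <ᵣ t → ∃ (t ∶ m ↦_))
        (close : ∀ {t m p c} → t ∶ m ↦ c → t ∶ m + p ↦ c → size (p · α) <ᵣ t) where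

        -- The extra colour `zero` is reserved for `T` and produces the summand 1 in the bound. A
        -- smaller value takes the colour of a multiple out of the middle's reach.
        _~_ : R → Fin (suc k) → Set ℓ
        s ~ zero    = s ≈ T
        s ~ (suc c) = ∃ λ m → (m ≤ P × ¬ Reach N h m) × s ≈ size (m · α) × T ∶ m ↦ c

        ∃-colour : ∀ {s} → s ∈ distanceValues O → ∃ (s ~_)
        ∃-colour {s} s∈
          with _ , x∈O , refl ← ∈-map⁻ (nearestDistance O)
                 (∈.∈-deduplicate⁻ (λ _ _ → em) (map (nearestDistance O) O) s∈)
          with n , n≤P , refl ← ∈-orbit⁻ x∈O
          with em {P = δ n ≈ T}
        ... | yes δn≈T = zero , δn≈T
        ... | no  δn≉T =
          let m , reach , mα≉ε , eq = δ-attained n≤P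
              mα<T = ≈-<-trans (sym eq) (δ-≤-T n≤P , δn≉T)
              c , m↦c = coloured mα<T
          in suc c , m , (ℕ.≤-pred (Reach⇒< n≤P reach) ,
             -- Were `m` within reach of the middle, `T` would not exceed `size (m · α)`.
             λ reach → <⇒≱ mα<T (δ-≤ h≤P reach mα≉ε)) , eq , m↦c

        -- The common colour makes `p · α` shorter than `T`, although `p` is within the middle's
        -- reach. This is possible only if `p · α` is zero, and then both multiples coincide.
        size-≈ : ∀ {m p c} → ¬ Reach N h m → m + p ≤ P → T ∶ m ↦ c → T ∶ m + p ↦ c →
                 size ((m + p) · α) ≈ size (m · α)
        size-≈ {m} {p} ¬reach m+p≤P m↦c m+p↦c with em {P = p · α ≈ₓ X.ε}
        ... | yes pα≈ε = size-cong (·≈ε⇒·-≈ m p pα≈ε)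
        ... | no  pα≉ε = contradiction
          (δ-≤ h≤P (¬Reach⇒Reach-difference ¬reach (s≤s m+p≤P)) pα≉ε)
          (<⇒≱ (close {p = p} m↦c m+p↦c))

        colour-injective : ∀ {s s′ c} → s ~ c → s′ ~ c → s ≈ s′
        colour-injective {c = zero}  s≈T s′≈T = trans s≈T (sym s′≈T)
        colour-injective {c = suc c} (m , (m≤P , ¬reach) , s≈ , m↦c)
                                     (m′ , (m′≤P , ¬reach′) , s′≈ , m′↦c)
          with ℕ.≤-total m m′
        ... | inj₁ m≤m′ with p , refl ← ℕ.m≤n⇒∃[o]m+o≡n m≤m′ =
          trans s≈ (trans (sym (size-≈ ¬reach m′≤P m↦c m′↦c)) (sym s′≈))
        ... | inj₂ m′≤m with p , refl ← ℕ.m≤n⇒∃[o]m+o≡n m′≤m =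
          trans s≈ (trans (size-≈ ¬reach′ m≤P m′↦c m↦c) (sym s′≈))

        distanceValues-≤ : length (distanceValues O) ≤ suc k
        distanceValues-≤ = length≤colours
          (deduplicate-! (record { isDecEquivalence = record
             { isEquivalence = isEquivalence ; _≟_ = λ r s → em {P = r ≈ s} } })
             (map (nearestDistance O) O))
          ∃-colour (λ {_} {_} {c} → colour-injective {c = c})

    -- Only lists with at least two entries matter, and their first two entries are the pair of
    -- different points that `bound` asks for.
    countDistances-≤ : ∀ {k} O → AllPairs (λ x y → ¬ x ≈ₓ y) O →
      (∀ {x y} → x ∈ O → y ∈ O → ¬ x ≈ₓ y → length (distanceValues O) ≤ k) →
      countDistances O ≤ k
    countDistances-≤ []           _                _     = z≤n
    countDistances-≤ (_ ∷ [])     _                _     = z≤n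
    countDistances-≤ (x ∷ y ∷ ys) ((x≉y ∷ _) ∷ _) bound = bound (here refl) (there (here refl)) x≉y

    gapCount-≤ : ∀ {k} (_∶_↦_ : R → ℕ → Fin k → Set ℓ) →
      (∀ {t m} → size (m · α) <ᵣ t → ∃ (t ∶ m ↦_)) →
      (∀ {t m p c} → t ∶ m ↦ c → t ∶ m + p ↦ c → size (p · α) <ᵣ t) →
      gapCount N α ≤ k + 1
    gapCount-≤ {k} _∶_↦_ coloured close = ℕ.≤-trans
      (countDistances-≤ O
        (deduplicate-! (record { isDecEquivalence = record
           { isEquivalence = X.isEquivalence ; _≟_ = λ x y → em {P = x ≈ₓ y} } })
           (map (_· α) (upTo N)))
        (λ x∈O y∈O x≉y → distanceValues-≤ x∈O y∈O x≉y _∶_↦_ coloured close))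
      (ℕ.≤-reflexive (ℕ.+-comm 1 k))

  -- Quotient sizes and representatives.

  <⇒<⇒≥ : ∀ {x y} → (∀ {t} → x <ᵣ t → y <ᵣ t) → y ≤ᵣ x
  <⇒<⇒≥ imp = ≮⇒≥ (<-irrefl ∘ imp)

  module QuotientSize (G : SizedGroup) (H : Subgroup (SizedGroup.abelianGroup G))
    (size-cong : ∀ {x y} → SizedGroup._≈_ G x y → SizedGroup.size G x ≈ SizedGroup.size G y)
    (size-⁻¹ : ∀ x → SizedGroup.size G (SizedGroup._⁻¹ G x) ≈ SizedGroup.size G x) where

    private
      module G = SizedGroup G
      module G/H = SizedGroup (G /ₛ H)
    open Subgroup H
    open AbelianGroupProperties G.abelianGroup using (//-rightDividesˡ; ⁻¹-anti-homo-//)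
    module /ₚ = AbelianGroupProperties G/H.abelianGroup

    x//[x//y]≈y : ∀ x y → x G.// (x G.// y) G.≈ y
    x//[x//y]≈y x y = G.trans (G.∙-congˡ (⁻¹-anti-homo-// x y))
      (G.trans (G.comm x (y G.// x)) (//-rightDividesˡ x y))

    size-isInfimum : ∀ x →
      IsInfimum (λ t → ∃ λ h → Member h × t ≈ G.dist x h) (G/H.size x)
    size-isInfimum x =
      proj₂ (infimum (λ t → ∃ λ h → Member h × t ≈ G.dist x h)
        (G.dist x G.ε , G.ε , ε-closed , ≈-refl) _)

    -- A strict bound does not require the infimum to be attained: if every `G.dist x h` were at
    -- least `t`, then `t` would be a lower bound and hence at most the infimum.
    <⇒representative : ∀ {x t} → G/H.size x <ᵣ t → ∃ λ y → y G/H.≈ x × G.size y <ᵣ t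
    <⇒representative {x} {t} x<t with em {P = ∃ λ h → Member h × G.dist x h <ᵣ t}
    ... | yes (h , h∈H , x-h<t) =
      x G.// h , G/H.sym (resp (G.sym (x//[x//y]≈y x h)) h∈H) , x-h<t
    ... | no none = contradiction
      (proj₂ (size-isInfimum x) λ (h , h∈H , s≈) →
        ≤.≤-respʳ-≈ (sym s≈) (≮⇒≥ λ x-h<t → none (h , h∈H , x-h<t)))
      (<⇒≱ x<t)

    representative⇒< : ∀ {x y t} → y G/H.≈ x → G.size y <ᵣ t → G/H.size x <ᵣ t
    representative⇒< {x} {y} y≈x y<t = ≤-<-trans
      (proj₁ (size-isInfimum x)
        (x G.// y , G/H.sym y≈x , sym (size-cong (x//[x//y]≈y x y)))) y<t

    /-size-cong : ∀ {x y} → x G/H.≈ y → G/H.size x ≈ G/H.size y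
    /-size-cong x≈y = ≤.antisym (<⇒<⇒≥ (transfer (G/H.sym x≈y))) (<⇒<⇒≥ (transfer x≈y))
      where
      transfer : ∀ {x y t} → x G/H.≈ y → G/H.size x <ᵣ t → G/H.size y <ᵣ t
      transfer x≈y x<t = let z , z≈x , z<t = <⇒representative x<t in
        representative⇒< (G/H.trans z≈x x≈y) z<t

    /-size-⁻¹ : ∀ x → G/H.size (x G.⁻¹) ≈ G/H.size x
    /-size-⁻¹ x = ≤.antisym (<⇒<⇒≥ (transfer x)) (≤.trans
      (≤.reflexive (/-size-cong (G/H.sym (/ₚ.⁻¹-involutive x)))) (<⇒<⇒≥ (transfer (x G.⁻¹))))
      where
      transfer : ∀ x {t} → G/H.size x <ᵣ t → G/H.size (x G.⁻¹) <ᵣ t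
      transfer x x<t = let z , z≈x , z<t = <⇒representative x<t in
        representative⇒< (G/H.⁻¹-cong z≈x) (≈-<-trans (size-⁻¹ z) z<t)

  -- Cube vertices, norms, ultrametrics and cube coordinates.

  ∣-x∣≈∣x∣ : ∀ x → ∣ - x ∣ ≈ ∣ x ∣
  ∣-x∣≈∣x∣ x = trans (⊔-cong ≈-refl (⁻¹-involutive x)) (⊔-comm (- x) x)

  -- Otherwise `- 1#` is nonnegative, and so is its square `1#`.
  0≤1 : 0# ≤ᵣ 1#
  0≤1 with ≤.total 0# 1#
  ... | inj₁ 0≤1 = 0≤1
  ... | inj₂ 1≤0 = ≤.≤-respʳ-≈ (trans (-1*x≈-x (- 1#)) (⁻¹-involutive 1#))
    (*-nonneg 0≤-1 0≤-1)
    where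
    0≤-1 : 0# ≤ᵣ - 1#
    0≤-1 = ≤.≤-respˡ-≈ (-‿inverseʳ 1#) (x≤0⇒x+y≤y 1≤0)

  2# : R
  2# = 1# +ᵣ 1#

  1<2 : 1# <ᵣ 2#
  1<2 = 0≤x⇒y≤x+y 0≤1 , λ 1≈2 → 0≉1 (sym (identityʳ-unique 1# 1# (sym 1≈2)))

  0<2 : 0# <ᵣ 2#
  0<2 = ≤-<-trans 0≤1 1<2

  -- The coordinates of cube vertices; the two values are `2#` apart.
  unit : Fin 2 → R
  unit zero    = 1#
  unit (suc _) = - 1#

  ∣unit∣<2 : ∀ i → ∣ unit i ∣ <ᵣ 2#
  ∣unit∣<2 zero    = ⊔-< 1<2 (≤-<-trans (0≤x⇒-x≤0 0≤1) 0<2)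
  ∣unit∣<2 (suc _) = ∣-x∣<t (∣unit∣<2 zero)

  ∣unit-unit∣<2⇒≡ : ∀ i j → ∣ unit i +ᵣ - unit j ∣ <ᵣ 2# → i ≡ j
  ∣unit-unit∣<2⇒≡ zero       zero       _ = refl
  ∣unit-unit∣<2⇒≡ (suc zero) (suc zero) _ = refl
  ∣unit-unit∣<2⇒≡ zero (suc zero) <2 = contradiction
    (≈-<-trans (+-congˡ (sym (⁻¹-involutive 1#))) (proj₁ (⊔-<⁻ <2))) <-irrefl
  ∣unit-unit∣<2⇒≡ (suc zero) zero <2 = contradiction
    (≈-<-trans (trans (+-congˡ (sym (⁻¹-involutive 1#)))
      (sym (⁻¹-anti-homo‿- (- 1#) 1#))) (proj₂ (⊔-<⁻ <2))) <-irrefl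

  module Norm (V : NormedSpace) where
    open NormedSpace V
    open AbelianGroupProperties +ᴹ-abelianGroup using (inverseˡ-unique)

    -1*ₗ : ∀ v → - 1# *ₗ v ≈ᴹ -ᴹ v
    -1*ₗ v = inverseˡ-unique _ _ (begin
      - 1# *ₗ v +ᴹ v        ≈⟨ +ᴹ-congˡ (*ₗ-identityˡ v) ⟨
      - 1# *ₗ v +ᴹ 1# *ₗ v  ≈⟨ *ₗ-distribʳ v (- 1#) 1# ⟨
      (- 1# +ᵣ 1#) *ₗ v     ≈⟨ *ₗ-congʳ (-‿inverseˡ 1#) ⟩
      0# *ₗ v               ≈⟨ *ₗ-zeroˡ v ⟩
      0ᴹ                    ∎)
      where open import Relation.Binary.Reasoning.Setoid ≈ᴹ-setoid

    ∥-v∥≈∥v∥ : ∀ v → ∥ -ᴹ v ∥ ≈ ∥ v ∥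
    ∥-v∥≈∥v∥ v = begin
      ∥ -ᴹ v ∥            ≈⟨ ∥∥-cong (-1*ₗ v) ⟨
      ∥ - 1# *ₗ v ∥       ≈⟨ ∥∥-homogeneous (- 1#) v ⟩
      ∣ - 1# ∣ *ᵣ ∥ v ∥   ≈⟨ *-congʳ (∣-x∣≈∣x∣ 1#) ⟩
      ∣ 1# ∣ *ᵣ ∥ v ∥     ≈⟨ ∥∥-homogeneous 1# v ⟨
      ∥ 1# *ₗ v ∥         ≈⟨ ∥∥-cong (*ₗ-identityˡ v) ⟩
      ∥ v ∥               ∎
      where open import Relation.Binary.Reasoning.Setoid setoid

  module Ultrametric (U : UltrametricGroup) where
    private module U = UltrametricGroup U
    open SizedGroup U.sizedGroup using (size; _//_)
    open AbelianGroupProperties U.abelianGroup using (//-rightDividesˡ)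
    private module d = IsGeneralMetric U.isUltrametric

    size-cong : ∀ {u w} → u U.≈ w → size u ≈ size w
    size-cong u≈w = d.cong u≈w U.refl

    size-// : ∀ u w → size (u // w) ≈ U.d u w
    size-// u w = trans (sym U.translationInvariant)
      (d.cong (//-rightDividesˡ w u) (U.identityˡ w))

    size-⁻¹ : ∀ u → size (u U.⁻¹) ≈ size u
    size-⁻¹ u = trans (size-cong (U.sym (U.identityˡ (u U.⁻¹))))
      (trans (size-// U.ε u) (d.sym U.ε u))

    -- The strong triangle inequality through `U.ε`. Since strict bounds survive differences in `U`,
    -- the colouring has to look only at the real coordinates.
    size-//-< : ∀ {u w t} → size u <ᵣ t → size w <ᵣ t → size (u // w) <ᵣ t
    size-//-< {u} {w} u<t w<t = ≈-<-trans (size-// u w)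
      (≤-<-trans (d.triangle u U.ε w) (⊔-< u<t (≈-<-trans (d.sym U.ε w) w<t)))

  module Cube {M : VectorSpace} {norm : LeftModule.Carrierᴹ M → R} {n}
    (x : CubeCoordinates M norm n) (norm-nonneg : ∀ v → 0# ≤ᵣ norm v) where
    open CubeCoordinates x public
    open LeftModule M
    open LeftModuleMorphisms rawLeftModule (LeftModule.rawLeftModule (ℝ^ n))
    open IsLeftModuleIsomorphism isLinearIsomorphism public

    norm-<⇒coord-< : ∀ {v t} → norm v <ᵣ t → ∀ i → ∣ coord v i ∣ <ᵣ t
    norm-<⇒coord-< {v} v<t = ∥∥∞-<⁻ (coord v) (≈-<-trans (sym (isometric v)) v<t)

    coord-<⇒norm-< : ∀ {v t} → 0# <ᵣ t → (∀ i → ∣ coord v i ∣ <ᵣ t) → norm v <ᵣ t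
    coord-<⇒norm-< {v} 0<t v<t = ≈-<-trans (isometric v) (∥∥∞-< (coord v) 0<t v<t)

    coord-sub : ∀ v w i → coord (v +ᴹ -ᴹ w) i ≈ coord v i +ᵣ - coord w i
    coord-sub v w i = trans (+ᴹ-homo v (-ᴹ w) i) (+-congˡ (-ᴹ-homo w i))

  -- The orthant colouring of multiples in the quotient.

  module _ (V : NormedSpace) (U : UltrametricGroup)
    (Λ : Subgroup (SizedGroup.abelianGroup
                    (NormedSpace.sizedGroup V ×ₛ UltrametricGroup.sizedGroup U)))
    where
    open Quotient V U Λ
    private
      module V = NormedSpace V
      module U = SizedGroup (UltrametricGroup.sizedGroup U)
      module Λ = Subgroup Λ
      module X = SizedGroup X
      module |U| = Ultrametric U
    module X/ = QuotientSize V×U Λ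
      (λ (v≈w , u≈z) → ⊔-cong (V.∥∥-cong v≈w) (|U|.size-cong u≈z))
      (λ (v , u) → ⊔-cong (Norm.∥-v∥≈∥v∥ V v) (|U|.size-⁻¹ u))
    module V/ = QuotientSize V.sizedGroup W V.∥∥-cong (Norm.∥-v∥≈∥v∥ V)

    module _ {n} (f : V.Carrierᴹ → Fin n → R) where

      Small : R → X.Carrier → Set ℓ
      Small t (v , u) = (∀ i → ∣ f v i ∣ <ᵣ t) × U.size u <ᵣ t

    -- `f` stands for the coordinates of `V` or for those of `V̄`, read on representatives in `V`.
    -- The list `S` holds the coordinates that define orthants; every other coordinate vanishes on
    -- `Λ`.
    module OrthantColouring {n} (f : V.Carrierᴹ → Fin n → R)
      (f-+ : ∀ v w i → f (v V.+ᴹ w) i ≈ f v i +ᵣ f w i)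
      (f-sub : ∀ v w i → f (v V.+ᴹ V.-ᴹ w) i ≈ f v i +ᵣ - f w i)
      (f-0 : ∀ i → f V.0ᴹ i ≈ 0#)
      (<⇒small : ∀ {x t} → X.size x <ᵣ t → ∃ λ y → y X.≈ x × Small f t y)
      (small⇒< : ∀ {x t} → Small f t x → X.size x <ᵣ t)
      (S : List (Fin n))
      (S-complete : ∀ i → i ∈ S ⊎ (∀ {a} → Λ.Member a → f (proj₁ a) i ≈ 0#))
      (α : X.Carrier) (P : ℕ) where

      open ColourBound X X/./-size-cong X/./-size-⁻¹ α P
      open RawMonoidDefs X.rawMonoid using () renaming (_×_ to _·_)

      -- A multiple may have small representatives in several orthants, and then it carries several
      -- colours.
      _∶_↦_ : R → ℕ → Fin (2 ^ length S) → Set ℓ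
      t ∶ m ↦ c = ∃ λ y →
        y X.≈ m · α × Small f t y × orthant (λ j → f (proj₁ y) (lookup S j)) ≡ c

      coloured : ∀ {t m} → X.size (m · α) <ᵣ t → ∃ (t ∶ m ↦_)
      coloured mα<t = let y , y≈ , small = <⇒small mα<t in _ , y , y≈ , small , refl

      module _ {i} (f-Λ : ∀ {a} → Λ.Member a → f (proj₁ a) i ≈ 0#) where

        -- Representatives of one point differ by an element of `Λ`, so such a coordinate is well
        -- defined on `X`.
        f-resp : ∀ {x y} → x X.≈ y → f (proj₁ x) i ≈ f (proj₁ y) i
        f-resp {v , _} {w , _} x≈y =
          x∙y⁻¹≈ε⇒x≈y _ _ (trans (sym (f-sub v w i)) (f-Λ x≈y))
          where open AbelianGroupProperties +-abelianGroup using (x∙y⁻¹≈ε⇒x≈y)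

        f-·-nonneg : 0# ≤ᵣ f (proj₁ α) i → ∀ m → 0# ≤ᵣ f (proj₁ (m · α)) i
        f-·-nonneg 0≤α zero    = ≤.reflexive (sym (f-0 i))
        f-·-nonneg 0≤α (suc m) = ≤.trans (f-·-nonneg 0≤α m)
          (≤.trans (0≤x⇒y≤x+y 0≤α) (≤.reflexive (sym (f-+ _ _ i))))

        f-·-nonpos : f (proj₁ α) i ≤ᵣ 0# → ∀ m → f (proj₁ (m · α)) i ≤ᵣ 0#
        f-·-nonpos α≤0 zero    = ≤.reflexive (f-0 i)
        f-·-nonpos α≤0 (suc m) = ≤.trans (≤.reflexive (f-+ _ _ i))
          (≤.trans (x≤0⇒x+y≤y α≤0) (f-·-nonpos α≤0 m))

        -- The weak sign of `α` in this coordinate passes to all its multiples and, by `f-resp`, to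
        -- all their representatives.
        f-SameSign : ∀ {y y′ m m′} → y X.≈ m · α → y′ X.≈ m′ · α →
                     SameSign (f (proj₁ y′) i) (f (proj₁ y) i)
        f-SameSign {m = m} {m′} y≈ y′≈ with ≤.total 0# (f (proj₁ α) i)
        ... | inj₁ 0≤α = inj₁ ( ≤.≤-respʳ-≈ (sym (f-resp y′≈)) (f-·-nonneg 0≤α m′)
                              , ≤.≤-respʳ-≈ (sym (f-resp y≈)) (f-·-nonneg 0≤α m) )
        ... | inj₂ α≤0 = inj₂ ( ≤.≤-respˡ-≈ (sym (f-resp y′≈)) (f-·-nonpos α≤0 m′)
                              , ≤.≤-respˡ-≈ (sym (f-resp y≈)) (f-·-nonpos α≤0 m) )

      -- The difference `y′ // y` represents `p · α`. Its coordinates are small because signs agree,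
      -- by the common orthant on `S` and by `f-SameSign` elsewhere; its `U` part is small by the
      -- ultrametric inequality.
      close : ∀ {t m p c} → t ∶ m ↦ c → t ∶ m + p ↦ c → X.size (p · α) <ᵣ t
      close {t} {m} {p} (y@(v , u) , y≈ , (v<t , u<t) , refl)
                        (y′@(v′ , u′) , y′≈ , (v′<t , u′<t) , same) =
        ≈-<-trans (X/./-size-cong pα≈) (small⇒< (v′-v<t , |U|.size-//-< u′<t u<t))
        where
        pα≈ : p · α X.≈ y′ X.// y
        pα≈ = X.trans (X.sym (·-// m p)) (X.sym (X.∙-cong y′≈ (X.⁻¹-cong y≈)))

        sameSign : ∀ i → SameSign (f v′ i) (f v i)
        sameSign i with S-complete i
        ... | inj₁ i∈S = ≡.subst (λ i → SameSign (f v′ i) (f v i))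
          (≡.sym (lookup-index i∈S))
          (orthant-≡⇒SameSign (f v′ ∘ lookup S) (f v ∘ lookup S) same (Any.index i∈S))
        ... | inj₂ f-Λ = f-SameSign f-Λ {m = m} {m + p} y≈ y′≈

        v′-v<t : ∀ i → ∣ f (v′ V.+ᴹ V.-ᴹ v) i ∣ <ᵣ t
        v′-v<t i = ≈-<-trans (∣-∣-cong (f-sub v′ v i))
          (SameSign⇒∣x-y∣<t (sameSign i) (v′<t i) (v<t i))

      gapCount-≤-orthants : Gaps.gapCount em X (suc P) α ≤ 2 ^ length S + 1
      gapCount-≤-orthants = gapCount-≤ _∶_↦_
        (λ {t} {m} → coloured {t} {m}) (λ {t} {m} {p} → close {t} {m} {p})

    module _ {t : R} {x : X.Carrier} where

      ⊔-size-<⁻ : X.size x <ᵣ t → ∃ λ y → y X.≈ x × V.∥ proj₁ y ∥ <ᵣ t × U.size (proj₂ y) <ᵣ t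
      ⊔-size-<⁻ x<t = let y , y≈x , y<t = X/.<⇒representative x<t in y , y≈x , ⊔-<⁻ y<t

      -- Positivity is read off the `U` part, which is present even if there are no coordinates.
      small⇒0<t : ∀ {n} {f : V.Carrierᴹ → Fin n → R} → Small f t x → 0# <ᵣ t
      small⇒0<t (_ , u<t) = ≤-<-trans (U.size-nonneg (proj₂ x)) u<t

    gapCount-≤-cube : ∀ {d} → CubeCoordinates V.vectorSpace V.∥_∥ d →
      ∀ α P → Gaps.gapCount em X (suc P) α ≤ 2 ^ d + 1
    gapCount-≤-cube {d} x α P = ≡.subst (λ k → Gaps.gapCount em X (suc P) α ≤ 2 ^ k + 1)
      (length-tabulate {n = d} (λ i → i))
      (OrthantColouring.gapCount-≤-orthants coord +ᴹ-homo coord-sub 0ᴹ-homo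
        (λ x<t → let y , y≈x , v<t , u<t = ⊔-size-<⁻ x<t in
          y , y≈x , norm-<⇒coord-< v<t , u<t)
        (λ small@(v<t , u<t) → X/.representative⇒< X.refl
          (⊔-< (coord-<⇒norm-< (small⇒0<t {f = coord} small) v<t) u<t))
        -- All `d` coordinates define orthants, so the first alternative always applies.
        (allFin d) (inj₁ ∘ ∈-allFin) α P)
      where open Cube x V.∥∥-nonneg

    -- The reduced real factor: gap bound and dimension.

    module _ {n} (x : CubeCoordinates V̄ ∥_∥V̄ n) where
      open Cube x (SizedGroup.size-nonneg sizedV̄)

      gapCount-≤-reducedCube :
        ∀ α P → Gaps.gapCount em X (suc P) α ≤ 2 ^ occurringDirections x em + 1
      gapCount-≤-reducedCube =
        OrthantColouring.gapCount-≤-orthants coord +ᴹ-homo coord-sub 0ᴹ-homo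
          (λ x<t → let y , y≈x , v<t , u<t = ⊔-size-<⁻ x<t in
            y , y≈x , norm-<⇒coord-< (V/.representative⇒< V̄.refl v<t) , u<t)
          small⇒<
          (filter (λ i → em {P = Occurs x i}) (allFin n)) occurs-complete
        where
        module V̄ = SizedGroup sizedV̄

        -- The quotient norm controls `v` only modulo `W`. Replacing `v` by a short `w` in its class
        -- is harmless in `X`: membership in `W`, taken at the scalar `1#`, puts `(w - v , 0)` in
        -- `Λ`.
        small⇒< : ∀ {a t} → Small coord t a → X.size a <ᵣ t
        small⇒< {v , u} small@(v<t , u<t) =
          let w , w≈v , w<t = V/.<⇒representative
                (coord-<⇒norm-< (small⇒0<t {f = coord} small) v<t)
          in X/.representative⇒<
               (Λ.resp (V.*ₗ-identityˡ _ , U.sym (U.inverseʳ u)) (w≈v 1#))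
               (⊔-< w<t u<t)

        occurs-complete : ∀ i → i ∈ filter (λ i → em {P = Occurs x i}) (allFin n)
          ⊎ (∀ {a} → Λ.Member a → coord (proj₁ a) i ≈ 0#)
        occurs-complete i with em {P = Occurs x i}
        ... | yes occurs = inj₁ (∈-filter⁺ (λ i → em {P = Occurs x i}) (∈-allFin i) occurs)
        ... | no ¬occurs = inj₂ vanishes
          where
          vanishes : ∀ {a} → Λ.Member a → coord (proj₁ a) i ≈ 0#
          vanishes {a} a∈Λ with em {P = coord (proj₁ a) i ≈ 0#}
          ... | yes a≈0 = a≈0
          ... | no  a≉0 = contradiction (a , (a , a∈Λ , V̄.refl , U.refl) , a≉0) ¬occurs

      occurringDirections-≤ : occurringDirections x em ≤ n
      occurringDirections-≤ = ℕ.≤-trans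
        (length-filter (λ i → em {P = Occurs x i}) (allFin n))
        (ℕ.≤-reflexive (length-tabulate (λ i → i)))

      -- Lift the vertices of the cube of V̄ to vectors of norm < 2 in V.  Two of them in one
      -- orthant of V are at distance < 2, whereas distinct vertices are at distance 2.
      dimension-≤ : ∀ {d} → CubeCoordinates V.vectorSpace V.∥_∥ d → n ≤ d
      dimension-≤ {d} x′ = ℕ.≮⇒≥ λ d<n →
        -- From `d < n` the cube of `V̄` has more vertices than `V` has orthants.
        let c , c′ , c<c′ , same = pigeonhole (ℕ.^-monoʳ-< 2 (s≤s (s≤s z≤n)) d<n)
              (orthant ∘ V′.coord ∘ lift)
        in <⇒≢ c<c′ (finToFun-injective {2} {n} c c′ (agree c c′ same))
        where
        module V̄ = SizedGroup sizedV̄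
        module V′ = Cube x′ V.∥∥-nonneg

        vertex : Fin (2 ^ n) → Fin n → R
        vertex c i = unit (finToFun {2} {n} c i)

        vertex⁻¹ : Fin (2 ^ n) → V.Carrierᴹ
        vertex⁻¹ c = proj₁ (surjective (vertex c))

        coord-vertex⁻¹ : ∀ c i → coord (vertex⁻¹ c) i ≈ vertex c i
        coord-vertex⁻¹ c = proj₂ (surjective (vertex c)) V̄.refl

        -- The strict bound `2#` exceeds the norm of every vertex, so a lift below it exists, yet it
        -- does not exceed the distance between distinct vertices.
        representative : ∀ c → ∃ λ v → v V̄.≈ vertex⁻¹ c × V.∥ v ∥ <ᵣ 2#
        representative c = V/.<⇒representative (coord-<⇒norm-< 0<2 λ i →
          ≈-<-trans (∣-∣-cong (coord-vertex⁻¹ c i)) (∣unit∣<2 (finToFun {2} {n} c i)))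

        lift : Fin (2 ^ n) → V.Carrierᴹ
        lift c = proj₁ (representative c)

        coord-lift : ∀ c i → coord (lift c) i ≈ vertex c i
        coord-lift c i = trans (⟦⟧-cong (proj₁ (proj₂ (representative c))) i) (coord-vertex⁻¹ c i)

        module _ (c c′ : Fin (2 ^ n))
          (same : orthant (V′.coord (lift c)) ≡ orthant (V′.coord (lift c′))) where

          difference : V.Carrierᴹ
          difference = lift c V.+ᴹ V.-ᴹ lift c′

          ∥difference∥<2 : V.∥ difference ∥ <ᵣ 2#
          ∥difference∥<2 = V′.coord-<⇒norm-< 0<2 λ i →
            ≈-<-trans (∣-∣-cong (V′.coord-sub (lift c) (lift c′) i)) (SameSign⇒∣x-y∣<t
              (orthant-≡⇒SameSign (V′.coord (lift c)) (V′.coord (lift c′)) same i)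
              (V′.norm-<⇒coord-< (proj₂ (proj₂ (representative c))) i)
              (V′.norm-<⇒coord-< (proj₂ (proj₂ (representative c′))) i))

          agree : ∀ i → finToFun {2} {n} c i ≡ finToFun {2} {n} c′ i
          agree i = ∣unit-unit∣<2⇒≡ _ _ (≈-<-trans
            (∣-∣-cong (trans (+-cong (sym (coord-lift c i)) (-‿cong (sym (coord-lift c′ i))))
              (sym (coord-sub (lift c) (lift c′) i))))
            (norm-<⇒coord-< (V/.representative⇒< V̄.refl ∥difference∥<2) i))

corollary2 :
    ∀ {ℓ} (em : ExcludedMiddle ℓ) (ℝ : CompleteOrderedField ℓ) →
    let open OverReals ℝ in
    (d : ℕ) → 1 ≤ d →
    (V : NormedSpace) →
    CubeCoordinates (NormedSpace.vectorSpace V) (NormedSpace.∥_∥ V) d →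
    (U : UltrametricGroup) →
    (Λ : Subgroup (SizedGroup.abelianGroup (NormedSpace.sizedGroup V ×ₛ UltrametricGroup.sizedGroup U))) →
    let open Quotient V U Λ
        open Gaps em X
    in
    SizedGroup.IsClosed V×U (Subgroup.Member Λ) →
    (α : SizedGroup.Carrier X) (N : ℕ) → 2 ≤ N →
    (gapCount N α ≤ 2 ^ d + 1)
    × (∀ {dimV̄} (x : CubeCoordinates V̄ ∥_∥V̄ dimV̄) →
        let k = occurringDirections x em in
        (gapCount N α ≤ 2 ^ k + 1) × (k ≤ dimV̄) × (dimV̄ ≤ d))
corollary2 em ℝ d _ V x U Λ _ α (suc P) _ =
    gapCount-≤-cube V U Λ x α P
  , λ x̄ → gapCount-≤-reducedCube V U Λ x̄ α P
        , occurringDirections-≤ V U Λ x̄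
        , dimension-≤ V U Λ x̄ x
  where open RealField em ℝ
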